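{- Let $G=(V,E)$ be a finite, simple (loop-free) undirected graph with $|V|=n\ge 1$ and $|E|=q$, and let $w:E\to\{1,\ldots,q\}$ be a weight function assigning different weights to different edges. Then $P_d(w,G)\ge 2\cdot\lfloor q/n\rfloor$, i.e., there exists a strictly decreasing trail of length $2\cdot\lfloor q/n\rfloor$ in $G$.
   Context: Edges are undirected, and $|E|$ counts each undirected edge once. A trail of length $k\ge 0$ in $G$ is a sequence $(e_1,\ldots,e_k)$ of distinct edges for which there is a sequence of vertices $(v_0,\ldots,v_k)$ with $e_i=v_{i-1}v_i$ for all $1\le i\le k$ (vertices may repeat; the empty trail has length $0$). A trail is strictly decreasing (with respect to $w$) if $w(e_i)>w(e_{i+1})$ for all $1\le i<k$. $P_d(w,G)$ denotes the length of a longest strictly decreasing trail in $G$. -}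

module Defs where

open import Data.Fin.Base using (Fin)
open import Data.List.Base using (List; []; _∷_; length)
open import Data.List.Relation.Unary.Linked using (Linked)
open import Data.List.Relation.Unary.Unique.Propositional using (Unique)
open import Data.Nat.Base using (ℕ; _≤_; _>_)
open import Data.Product.Base using (_×_; _,_; ∃-syntax)
open import Data.Sum.Base using (_⊎_)
open import Function.Bundles using (_↔_)
open import Level using (Level; suc; _⊔_)
open import Relation.Binary.PropositionalEquality.Core using (_≡_)
open import Relation.Nullary.Negation.Core using (¬_)

-- n is the number of vertices and q the number of (undirected) edges.
-- An unordered pair of endpoints is represented by an arbitrarily ordered
-- one; only the symmetric relation Joins is used below.  By `simple`, an
-- edge is determined by its unordered pair of endpoints, so E amounts to
-- a set of two-element subsets of V.
record FiniteSimpleGraph (a b : Level) (n q : ℕ) : Set (suc (a ⊔ b)) where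
  field
    V    : Set a
    E    : Set b
    V↔   : V ↔ Fin n
    E↔   : E ↔ Fin q
    ends : E → V × V

  Joins : E → V → V → Set a
  Joins e u v = ends e ≡ (u , v) ⊎ ends e ≡ (v , u)

  field
    loopFree : ∀ {e v} → ¬ Joins e v v
    simple   : ∀ {e f u v} → Joins e u v → Joins f u v → e ≡ f

module _ {a b : Level} {n q : ℕ} (G : FiniteSimpleGraph a b n q) where
  open FiniteSimpleGraph G

  infixr 5 _∷_

  -- Walk (e₁ ∷ … ∷ eₖ ∷ []) (v₀ ∷ … ∷ vₖ ∷ []) says that
  -- eᵢ = vᵢ₋₁vᵢ for all 1 ≤ i ≤ k.
  data Walk : List E → List V → Set (a ⊔ b) where
    [-] : ∀ {v} → Walk [] (v ∷ [])
    _∷_ : ∀ {e es u v vs} → Joins e u v → Walk es (v ∷ vs) →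
          Walk (e ∷ es) (u ∷ v ∷ vs)

  IsTrail : List E → Set (a ⊔ b)
  IsTrail es = Unique es × ∃[ vs ] Walk es vs

  StrictlyDecreasing : (E → ℕ) → List E → Set b
  StrictlyDecreasing w = Linked (λ e f → w e > w f)

  IsDecreasingTrail : (E → ℕ) → List E → Set (a ⊔ b)
  IsDecreasingTrail w es = IsTrail es × StrictlyDecreasing w es

  -- IsP_d w p says that P_d(w, G) = p.
  IsP_d : (E → ℕ) → ℕ → Set (a ⊔ b)
  IsP_d w p = (∃[ es ] IsDecreasingTrail w es × length es ≡ p)
            × (∀ es → IsDecreasingTrail w es → length es ≤ p)

{-# OPTIONS --safe #-}
module Submission where

-- Let L t v be the length of a longest decreasing trail from v all of whose
-- weights are below t.  If the edge uv has weight t, putting it in front of the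
-- longest trails from v and from u gives L (t+1) u ≥ L t v + 1 and
-- L (t+1) v ≥ L t u + 1, so that each edge adds at least 2 to the sum of L over
-- all vertices.  The final sum is at least 2q, and some vertex reaches the average.

open import Defs
import Algebra.Properties.CommutativeMonoid.Sum as Sum
open import Data.Empty using (⊥-elim)
open import Data.Fin.Base using (Fin; zero; suc; toℕ; fromℕ<; punchIn; punchOut)
import Data.Fin.Properties as Fin
open import Data.List.Base using (List; []; _∷_; length; allFin)
open import Data.List.Extrema.Nat using (argmax; f[xs]≤f[argmax])
open import Data.List.Membership.Propositional.Properties using (∈-allFin)
import Data.List.Relation.Unary.All as All
import Data.List.Relation.Unary.AllPairs as AllPairs
open import Data.List.Relation.Unary.Linked using ([]; [-]; _∷_)
open import Data.List.Relation.Unary.Linked.Properties using (Linked⇒AllPairs)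
open import Data.List.Relation.Unary.Unique.Propositional using (Unique)
open import Data.Nat.Base
open import Data.Nat.DivMod using (m/n*n≤m)
open import Data.Nat.Properties
open import Data.Nat.Tactic.RingSolver using (solve-∀)
open import Data.Product.Base using (_×_; _,_; ∃-syntax; proj₁; proj₂)
open import Data.Product.Properties using (,-injective)
open import Data.Sum.Base using (inj₁; inj₂)
open import Data.Vec.Functional using (Vector; removeAt)
open import Function.Base using (_∘_; flip)
open import Function.Bundles using (Inverse)
open import Function.Definitions using (Injective)
open import Function.Properties.Inverse using (↔⇒↣)
open import Level using (Level) renaming (_⊔_ to _⊔ᴸ_)
open import Relation.Binary.Definitions using (DecidableEquality)
open import Relation.Binary.PropositionalEquality
open import Relation.Nullary using (Dec; yes; no)
open import Relation.Nullary.Decidable using (via-injection; map′; _×-dec_)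
open FiniteSimpleGraph using (E)
open Sum +-0-commutativeMonoid using (sum; sum-remove)

private variable
  a b : Level
  m n q : ℕ

-- Finite index sets and sums of natural numbers

-- If `j` were missed, `punchOut` would delete it from the codomain and leave an injection into a
-- set with one element fewer, against the pigeonhole principle.
injective⇒surjective : (f : Fin n → Fin n) → Injective _≡_ _≡_ f → ∀ j → ∃[ i ] f i ≡ j
injective⇒surjective {suc n} f f-injective j with Fin.any? (λ i → f i Fin.≟ j)
... | yes hit = hit
... | no miss =
  ⊥-elim (Fin.<⇒notInjective {f = avoid} (n<1+n n)
    (f-injective ∘ Fin.punchOut-injective (j≢f _) (j≢f _)))
  where
  j≢f : ∀ i → j ≢ f i
  j≢f i j≡fi = miss (i , sym j≡fi)

  avoid : Fin (suc n) → Fin n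
  avoid i = punchOut (j≢f i)

sum-mono-≤ : (f g : Vector ℕ n) → (∀ i → f i ≤ g i) → sum f ≤ sum g
sum-mono-≤ {zero}  f g f≤g = z≤n
sum-mono-≤ {suc n} f g f≤g =
  +-mono-≤ (f≤g zero) (sum-mono-≤ (f ∘ suc) (g ∘ suc) (f≤g ∘ suc))

sum-≤-* : (f : Vector ℕ n) → (∀ i → f i ≤ m) → sum f ≤ n * m
sum-≤-* {zero}  f f≤m = z≤n
sum-≤-* {suc n} f f≤m = +-mono-≤ (f≤m zero) (sum-≤-* (f ∘ suc) (f≤m ∘ suc))

-- Once entry `i` is gone, the old entry `j` sits at position `punchOut i≢j`.
sum-remove-pair : (f : Vector ℕ (suc (suc n))) {i j : Fin (suc (suc n))} (i≢j : i ≢ j) →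
                  sum f ≡ (f i + f j) + sum (removeAt (removeAt f i) (punchOut i≢j))
sum-remove-pair f {i} {j} i≢j = begin
  sum f                         ≡⟨ sum-remove {i = i} f ⟩
  f i + sum (removeAt f i)      ≡⟨ cong (f i +_) (sum-remove {i = punchOut i≢j} (removeAt f i)) ⟩
  f i + (f (punchIn i (punchOut i≢j)) + rest)
                                ≡⟨ cong (λ k → f i + (f k + rest)) (Fin.punchIn-punchOut i≢j) ⟩
  f i + (f j + rest)            ≡⟨ +-assoc (f i) (f j) rest ⟨
  (f i + f j) + rest            ∎
  where
  open ≡-Reasoning
  rest = sum (removeAt (removeAt f i) (punchOut i≢j))

-- Meant for the two ends of an edge: the joint gain is known only for the pair `i`, `j`, and the
-- remaining entries are compared by monotonicity.
sum-gain : ∀ d (f g : Vector ℕ n) → (∀ i → f i ≤ g i) → ∀ {i j} → i ≢ j →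
           d + (f i + f j) ≤ g i + g j → d + sum f ≤ sum g
-- A single index cannot supply two distinct ones.
sum-gain {suc zero} d f g f≤g {zero} {zero} i≢j gain = ⊥-elim (i≢j refl)
sum-gain {suc (suc n)} d f g f≤g {i} {j} i≢j gain = begin
  d + sum f                     ≡⟨ cong (d +_) (sum-remove-pair f i≢j) ⟩
  d + ((f i + f j) + rest f)    ≡⟨ +-assoc d (f i + f j) (rest f) ⟨
  (d + (f i + f j)) + rest f    ≤⟨ +-mono-≤ gain (sum-mono-≤ (removed f) (removed g) λ k → f≤g _) ⟩
  (g i + g j) + rest g          ≡⟨ sum-remove-pair g i≢j ⟨
  sum g                         ∎
  where
  open ≤-Reasoning
  removed : Vector ℕ (suc (suc n)) → Vector ℕ n
  removed h = removeAt (removeAt h i) (punchOut i≢j)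

  rest : Vector ℕ (suc (suc n)) → ℕ
  rest h = sum (removed h)

argmax-Fin : .{{_ : NonZero n}} (f : Fin n → ℕ) → ∃[ i ] ∀ j → f j ≤ f i
-- `argmax` starts from a default value; any index will do, and `zero` exists because the index set
-- is nonempty.
argmax-Fin {suc n} f = argmax f zero (allFin _) ,
  λ j → All.lookup (f[xs]≤f[argmax] {f = f} zero (allFin _)) (∈-allFin j)

-- Decreasing trails as descents below a weight bound

module _ (G : FiniteSimpleGraph a b n q) (w : E G → ℕ) where
  open FiniteSimpleGraph G hiding (E)

  -- Decreasing walks from v with weights below t; the strict decrease makes
  -- the edges distinct, so these are trails.
  data Descent (t : ℕ) (v : V) : List (E G) → Set (a ⊔ᴸ b) where
    []   : Descent t v []
    step : ∀ {e y es} → Joins e v y → w e < t → Descent (w e) y es → Descent t v (e ∷ es)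

  weaken : ∀ {t t′ v es} → t ≤ t′ → Descent t v es → Descent t′ v es
  weaken t≤t′ []             = []
  weaken t≤t′ (step vy lt d) = step vy (<-≤-trans lt t≤t′) d

  Descent⇒Walk : ∀ {t v es} → Descent t v es → ∃[ vs ] Walk G es (v ∷ vs)
  Descent⇒Walk []            = [] , [-]
  Descent⇒Walk (step vy _ d) = _ , vy ∷ proj₂ (Descent⇒Walk d)

  Descent⇒StrictlyDecreasing : ∀ {t v es} → Descent t v es → StrictlyDecreasing G w es
  Descent⇒StrictlyDecreasing []                         = []
  Descent⇒StrictlyDecreasing (step _ _ [])              = [-]
  Descent⇒StrictlyDecreasing (step _ _ d@(step _ lt _)) = lt ∷ Descent⇒StrictlyDecreasing d

  -- By transitivity every earlier edge is heavier than every later one, and no edge is heavier than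
  -- itself.
  StrictlyDecreasing⇒Unique : ∀ {es} → StrictlyDecreasing G w es → Unique es
  StrictlyDecreasing⇒Unique dec =
    AllPairs.map (λ gt e≡f → <-irrefl (cong w (sym e≡f)) gt) (Linked⇒AllPairs (flip <-trans) dec)

  Descent⇒IsDecreasingTrail : ∀ {t v es} → Descent t v es → IsDecreasingTrail G w es
  Descent⇒IsDecreasingTrail d = (StrictlyDecreasing⇒Unique dec , _ , proj₂ (Descent⇒Walk d)) , dec
    where dec = Descent⇒StrictlyDecreasing d

  -- Each comparison of neighbouring weights becomes the bound for the descent that starts at the
  -- next edge.
  Walk⇒Descent : ∀ {t e es v vs} → w e < t → Walk G (e ∷ es) (v ∷ vs) →
                 StrictlyDecreasing G w (e ∷ es) → Descent t v (e ∷ es)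
  Walk⇒Descent lt (vy ∷ [-])          dec        = step vy lt []
  Walk⇒Descent lt (vy ∷ walk@(_ ∷ _)) (gt ∷ dec) = step vy lt (Walk⇒Descent gt walk dec)

  IsDecreasingTrail⇒Descent : ∀ {t es} → (∀ e → w e < t) → IsDecreasingTrail G w es →
                              ∃[ v ] Descent t v es
  IsDecreasingTrail⇒Descent w<t ((_ , _ , [-] {v}) , _) = v , []
  IsDecreasingTrail⇒Descent w<t ((_ , _ , walk@(_ ∷ _)) , dec) =
    _ , Walk⇒Descent (w<t _) walk dec

  -- A prefix of a descent is a descent from the same vertex; this turns a lower bound on the length
  -- into an exact length.
  truncate : ∀ {t v es} k → Descent t v es → k ≤ length es →
             ∃[ es′ ] (Descent t v es′ × length es′ ≡ k)
  truncate zero    d              _         = [] , [] , refl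
  truncate (suc k) (step vy lt d) (s≤s k≤m) with truncate k d k≤m
  ... | es′ , d′ , refl = _ , step vy lt d′ , refl

  -- Longest descents from a vertex

  IsLongest : ℕ → V → ℕ → Set (a ⊔ᴸ b)
  IsLongest t v l = (∃[ es ] (Descent t v es × length es ≡ l))
                  × (∀ {es} → Descent t v es → length es ≤ l)

  _≟V_ : DecidableEquality V
  _≟V_ = via-injection (↔⇒↣ V↔) Fin._≟_

  joins? : ∀ e v → Dec (∃[ y ] Joins e v y)
  joins? e v with ends e
  ... | x , y with x ≟V v | y ≟V v
  ... | yes refl | _        = yes (y , inj₁ refl)
  ... | no _     | yes refl = yes (x , inj₂ refl)
  ... | no x≢v   | no y≢v   = no λ where
    (_ , inj₁ refl) → x≢v refl
    (_ , inj₂ refl) → y≢v refl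

  Joins-functional : ∀ {e v y z} → Joins e v y → Joins e v z → y ≡ z
  Joins-functional (inj₁ p) (inj₁ r) = proj₂ (,-injective (trans (sym p) r))
  Joins-functional (inj₂ p) (inj₂ r) = proj₁ (,-injective (trans (sym p) r))
  -- Here `ends e` is both `(v , y)` and `(z , v)`, so all three vertices coincide; the next case is
  -- its mirror image.
  Joins-functional (inj₁ p) (inj₂ r) with refl , refl ← ,-injective (trans (sym p) r) = refl
  Joins-functional (inj₂ p) (inj₁ r) with refl , refl ← ,-injective (trans (sym p) r) = refl

  step? : ∀ t v → Dec (∃[ e ] (w e ≡ t × ∃[ y ] Joins e v y))
  step? t v = map′ (λ (i , p) → from i , p)
                   (λ (e , p) → to e , subst (λ e → w e ≡ t × ∃[ y ] Joins e v y)
                                               (sym (strictlyInverseʳ e)) p)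
                   (Fin.any? λ i → (w (from i) ≟ t) ×-dec joins? (from i) v)
    where
    open Inverse E↔

  module _ (w-injective : Injective _≡_ _≡_ w) where

    -- Raising the bound from `t` to `suc t` admits only edges of weight `t`, and such an edge can
    -- only come first. By injectivity there is at most one. If it joins `v` to `y`, the maximum at
    -- `v` becomes the larger of the old one and one plus the maximum at `y` below `t`; otherwise it
    -- stays.
    longest : ∀ t v → ∃[ l ] IsLongest t v l
    longest zero    v = 0 , ([] , [] , refl) , λ where [] → z≤n
    longest (suc t) v with longest t v | step? t v
    ... | l , (es , d , eq) , max | no ¬step = l , (es , weaken (n≤1+n t) d , eq) , max′
      where
      max′ : ∀ {es} → Descent (suc t) v es → length es ≤ l
      max′ [] = z≤n
      -- The first edge weighs at most `t`, and not exactly `t`, so the old bound already covers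
      -- this descent.
      max′ (step {e} vy lt d) =
        max (step vy (≤∧≢⇒< (s≤s⁻¹ lt) (λ w≡t → ¬step (e , w≡t , _ , vy))) d)
    ... | l , (es , d , eq) , max | yes (e , we≡t , y , vy) with longest t y
    ...   | k , (fs , d′ , eq′) , maxʸ = l ⊔ suc k , attained , max′
      where
      attained : ∃[ es ] (Descent (suc t) v es × length es ≡ l ⊔ suc k)
      attained with ≤-total l (suc k)
      ... | inj₁ l≤k = _ , step vy (s≤s (≤-reflexive we≡t)) (weaken (≤-reflexive (sym we≡t)) d′) ,
                         trans (cong suc eq′) (sym (m≤n⇒m⊔n≡n l≤k))
      ... | inj₂ k≤l = es , weaken (n≤1+n t) d , trans eq (sym (m≥n⇒m⊔n≡m k≤l))

      max′ : ∀ {es} → Descent (suc t) v es → length es ≤ l ⊔ suc k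
      max′ [] = z≤n
      max′ (step {f} vz lt d) with w f ≟ t
      ... | no w≢t = ≤-trans (max (step vz (≤∧≢⇒< (s≤s⁻¹ lt) w≢t) d)) (m≤m⊔n l (suc k))
      -- The first edge has weight `t`, hence is `e`, and its other end is `y`; the tail is then
      -- measured against the maximum at `y`.
      ... | yes wf≡t with refl ← w-injective (trans we≡t (sym wf≡t)) with refl ← Joins-functional vy vz =
        ≤-trans (s≤s (maxʸ (weaken (≤-reflexive wf≡t) d))) (m≤n⊔m l (suc k))

    L : ℕ → V → ℕ
    L t v = proj₁ (longest t v)

    longestDescent : ∀ t v → ∃[ es ] (Descent t v es × length es ≡ L t v)
    longestDescent t v = proj₁ (proj₂ (longest t v))

    length≤L : ∀ {t v es} → Descent t v es → length es ≤ L t v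
    length≤L {t} {v} = proj₂ (proj₂ (longest t v))

    L-mono : ∀ t v → L t v ≤ L (suc t) v
    L-mono t v with es , d , eq ← longestDescent t v =
      subst (_≤ L (suc t) v) eq (length≤L (weaken (n≤1+n t) d))

    L-step : ∀ e {u v} → Joins e u v → suc (L (w e) v) ≤ L (suc (w e)) u
    L-step e {u} {v} uv with es , d , eq ← longestDescent (w e) v =
      subst (λ l → suc l ≤ L (suc (w e)) u) eq (length≤L (step uv ≤-refl d))

    -- Growth of the sum of longest lengths over all vertices

    total : ℕ → ℕ
    total t = sum (L t ∘ Inverse.from V↔)

    total-step : ∀ e → 2 + total (w e) ≤ total (suc (w e))
    total-step e = sum-gain 2 _ _ (λ i → L-mono (w e) (from i)) to-u≢to-v (begin
      2 + (L (w e) (from (to u)) + L (w e) (from (to v)))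
        ≡⟨ cong₂ (λ x y → 2 + (L (w e) x + L (w e) y)) (strictlyInverseʳ u) (strictlyInverseʳ v) ⟩
      2 + (L (w e) u + L (w e) v)
        -- The summands cross over: the new value at each end is bounded below through the old value
        -- at the other end.
        ≡⟨ rearrange (L (w e) u) (L (w e) v) ⟩
      suc (L (w e) v) + suc (L (w e) u)
        ≤⟨ +-mono-≤ (L-step e (inj₁ refl)) (L-step e (inj₂ refl)) ⟩
      L (suc (w e)) u + L (suc (w e)) v
        ≡⟨ cong₂ (λ x y → L (suc (w e)) x + L (suc (w e)) y) (strictlyInverseʳ u) (strictlyInverseʳ v) ⟨
      L (suc (w e)) (from (to u)) + L (suc (w e)) (from (to v)) ∎)
      where
      open Inverse V↔
      open ≤-Reasoning
      u = proj₁ (ends e)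
      v = proj₂ (ends e)

      u≢v : u ≢ v
      u≢v u≡v = loopFree (inj₁ (cong (_, v) u≡v))

      to-u≢to-v : to u ≢ to v
      to-u≢to-v eq = u≢v (trans (sym (strictlyInverseʳ u)) (trans (cong from eq) (strictlyInverseʳ v)))

      rearrange : ∀ x y → 2 + (x + y) ≡ suc y + suc x
      rearrange = solve-∀

    module _ (w-bounded : ∀ e → 1 ≤ w e × w e ≤ q) where

      -- Weights shifted down by one give an injective self-map of `Fin q`, which is therefore onto.
      -- Hence no bound from 1 to `q` is passed without an edge contributing its gain.
      w-surjective : ∀ {s} → s < q → ∃[ e ] w e ≡ suc s
      w-surjective {s} s<q = from i , (begin
          w (from i)              ≡⟨ suc-pred-w (from i) ⟨
          suc (pred (w (from i))) ≡⟨ cong suc (Fin.toℕ-fromℕ< (pred-w<q (from i))) ⟨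
          suc (toℕ (f i))         ≡⟨ cong (suc ∘ toℕ) (proj₂ hit) ⟩
          suc (toℕ (fromℕ< s<q))  ≡⟨ cong suc (Fin.toℕ-fromℕ< s<q) ⟩
          suc s                   ∎)
        where
        open Inverse E↔
        open ≡-Reasoning
        suc-pred-w : ∀ e → suc (pred (w e)) ≡ w e
        suc-pred-w e = suc-pred (w e) {{>-nonZero (proj₁ (w-bounded e))}}

        pred-w<q : ∀ e → pred (w e) < q
        pred-w<q e = subst (_≤ q) (sym (suc-pred-w e)) (proj₂ (w-bounded e))

        f : Fin q → Fin q
        f i = fromℕ< (pred-w<q (from i))

        from-injective : Injective _≡_ _≡_ from
        from-injective {i} {j} eq = trans (sym (strictlyInverseˡ i)) (trans (cong to eq) (strictlyInverseˡ j))

        f-injective : Injective _≡_ _≡_ f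
        f-injective {i} {j} eq = from-injective (w-injective (begin
          w (from i)              ≡⟨ suc-pred-w (from i) ⟨
          suc (pred (w (from i))) ≡⟨ cong suc (Fin.fromℕ<-injective _ _ (pred-w<q (from i)) (pred-w<q (from j)) eq) ⟩
          suc (pred (w (from j))) ≡⟨ suc-pred-w (from j) ⟩
          w (from j)              ∎))

        hit : ∃[ j ] f j ≡ fromℕ< s<q
        hit = injective⇒surjective f f-injective (fromℕ< s<q)

        i : Fin q
        i = proj₁ hit

      -- The bound `suc s` admits exactly the weights 1 to `s`, that is, `s` edges, each of which
      -- has added at least 2.
      total-≥ : ∀ s → s ≤ q → 2 * s ≤ total (suc s)
      total-≥ zero    _   = z≤n
      total-≥ (suc s) s<q with e , eq ← w-surjective s<q = begin
        2 * suc s             ≡⟨ *-suc 2 s ⟩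
        2 + 2 * s             ≤⟨ +-monoʳ-≤ 2 (total-≥ s (<⇒≤ s<q)) ⟩
        2 + total (suc s)     ≤⟨ subst (λ t → 2 + total t ≤ total (suc t)) eq (total-step e) ⟩
        total (suc (suc s))   ∎
        where open ≤-Reasoning

theorem1 : {a b : Level} (n q : ℕ) .{{_ : NonZero n}}
    (G : FiniteSimpleGraph a b n q) (w : E G → ℕ) →
    (∀ e → 1 ≤ w e × w e ≤ q) →
    Injective _≡_ _≡_ w →
    (∃[ p ] (IsP_d G w p × p ≥ 2 * (q / n)))
    × (∃[ es ] (IsDecreasingTrail G w es × length es ≡ 2 * (q / n)))
theorem1 n q G w w-bounded w-injective
  -- The bound `suc q` admits every edge. The vertex of index `i` has the largest value, which is
  -- both the maximum over all trails and at least the average.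
  with i , i-max ← argmax-Fin (L G w w-injective (suc q) ∘ Inverse.from (FiniteSimpleGraph.V↔ G))
  with es , d , eq ← longestDescent G w w-injective (suc q) (Inverse.from (FiniteSimpleGraph.V↔ G) i)
  = (p , ((es , Descent⇒IsDecreasingTrail G w d , eq) , maximal) , p≥)
  , short
  where
  open FiniteSimpleGraph G using (V; V↔)
  open Inverse V↔
  ℓ : V → ℕ
  ℓ = L G w w-injective (suc q)

  p : ℕ
  p = ℓ (from i)

  ℓ≤p : ∀ v → ℓ v ≤ p
  ℓ≤p v = subst (λ x → ℓ x ≤ p) (strictlyInverseʳ v) (i-max (to v))

  maximal : ∀ fs → IsDecreasingTrail G w fs → length fs ≤ p
  maximal fs trail
    with v , d′ ← IsDecreasingTrail⇒Descent G w (λ e → s≤s (proj₂ (w-bounded e))) trail =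
    ≤-trans (length≤L G w w-injective d′) (ℓ≤p v)

  p≥ : p ≥ 2 * (q / n)
  -- The average argument multiplied through by `n`: the total lies between `2 * q` and `n * p`.
  p≥ = *-cancelˡ-≤ n (begin
    n * (2 * (q / n))    ≡⟨ rearrange n (q / n) ⟩
    2 * (q / n * n)      ≤⟨ *-monoʳ-≤ 2 (m/n*n≤m q n) ⟩
    2 * q                ≤⟨ total-≥ G w w-injective w-bounded q ≤-refl ⟩
    total G w w-injective (suc q) ≤⟨ sum-≤-* (ℓ ∘ from) i-max ⟩
    n * p                ∎)
    where
    open ≤-Reasoning
    rearrange : ∀ m k → m * (2 * k) ≡ 2 * (k * m)
    rearrange = solve-∀

  short : ∃[ fs ] (IsDecreasingTrail G w fs × length fs ≡ 2 * (q / n))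
  -- The longest descent may exceed the required length, so it is cut down to it.
  short with fs , d′ , eq′ ← truncate G w (2 * (q / n)) d (subst (2 * (q / n) ≤_) (sym eq) p≥) =
    fs , Descent⇒IsDecreasingTrail G w d′ , eq′
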